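{- Let $r\ge 3$ be an integer and $\mathcal{A}_r=\{0,1,2^r-1,2^r+1\}$. Then $\phi_{\mathcal{A}_r}(x)=1+x+x^{2^r-1}+x^{2^r+1}$, and the sequence $\left(f_{\mathcal{A}_r}(n)\right)_{n\ge 0}$ modulo $2$ is periodic with least period dividing $4^r-1$. Among any $4^r-1$ consecutive terms of $\left(f_{\mathcal{A}_r}(n)\right)_{n\ge0}$, exactly $4^r-3^r$ terms are odd and $3^r-1$ terms are even.
   Context: For a finite set $\mathcal{A}$ of non-negative integers containing $0$, $f_{\mathcal{A}}(n)$ denotes the number of ways to write the non-negative integer $n$ in the form $n=\sum_{i=0}^{\infty}\epsilon_i2^i$ with every $\epsilon_i\in\mathcal{A}$ (so all but finitely many $\epsilon_i$ are $0$), and $\phi_{\mathcal{A}}(x)=\sum_{a\in\mathcal{A}}x^a\in\mathbb{F}_2[x]$. -}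

module Defs where

open import Algebra.Bundles.Raw using (RawSemiring)
import Algebra.Definitions.RawSemiring as RawSemiringDefinitions
open import Data.Fin.Base using (Fin)
open import Data.List.Base
  using (List; []; _∷_; length; lookup; filter; map; foldr; applyUpTo; upTo; deduplicate; cartesianProductWith)
open import Data.List.Membership.Propositional using (_∈_)
open import Data.List.Membership.Propositional.Properties
  using (∈-filter⁺; ∈-filter⁻; ∈-lookup; ∈-deduplicate⁺; ∈-deduplicate⁻;
         ∈-cartesianProductWith⁺; ∈-cartesianProductWith⁻)
import Data.List.Relation.Unary.All as All
open import Data.List.Relation.Unary.Any using (here; index)
open import Data.List.Relation.Unary.Any.Properties using (lookup-index)
open import Data.List.Relation.Unary.AllPairs using ([]; _∷_)
open import Data.List.Relation.Unary.Unique.Propositional using (Unique)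
import Data.List.Relation.Unary.Unique.Propositional.Properties as Unique
open import Data.List.Relation.Unary.Unique.DecPropositional.Properties using (deduplicate-!)
open import Data.Nat.Base
open import Data.Nat.ListAction using (sum)
open import Data.Nat.Properties
open import Data.Parity.Base as ℙ using (Parity; 0ℙ; 1ℙ)
open import Data.Product.Base using (_×_; _,_; proj₁; proj₂)
open import Data.Vec.Base using (Vec; []; _∷_)
open import Data.Vec.Properties using (∷-injective)
open import Function.Base using (_∘_)
open import Function.Bundles using (Bijection)
open import Level using (0ℓ)
open import Relation.Binary.Bundles using (Setoid)
open import Relation.Binary.PropositionalEquality
open import Relation.Nullary.Decidable.Core using (yes; no)
open import Relation.Nullary.Negation using (contradiction)

-- A finite set of naturals is given by a list of its elements; order and
-- repetitions are irrelevant, since f and φ below remove the latter.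

elements : List ℕ → List ℕ
elements = deduplicate _≟_

𝒜 : ℕ → List ℕ
𝒜 r = 0 ∷ 1 ∷ 2 ^ r ∸ 1 ∷ 2 ^ r + 1 ∷ []

weight : ℕ → (ℕ → ℕ) → ℕ
weight N ε = sum (applyUpTo (λ i → ε i * 2 ^ i) N)

record Representation (A : List ℕ) (n : ℕ) : Set where
  field
    ε       : ℕ → ℕ
    ε∈A     : ∀ i → ε i ∈ A
    bound   : ℕ
    ε≡0     : ∀ i → bound ≤ i → ε i ≡ 0
    value≡n : weight bound ε ≡ n

open Representation public

representations : List ℕ → ℕ → Setoid 0ℓ 0ℓ
representations A n = record
  { Carrier       = Representation A n
  ; _≈_           = λ R S → ∀ i → ε R i ≡ ε S i
  ; isEquivalence = record
    { refl  = λ i → refl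
    ; sym   = λ p i → sym (p i)
    ; trans = λ p q i → trans (p i) (q i)
    }
  }

words : List ℕ → (k : ℕ) → List (Vec ℕ k)
words A zero    = [] ∷ []
words A (suc k) = cartesianProductWith _∷_ A (words A k)

digits : ∀ {k} → Vec ℕ k → ℕ → ℕ
digits []      i       = 0
digits (a ∷ w) zero    = a
digits (a ∷ w) (suc i) = digits w i

-- As n < 2 ^ n, a representation of n has all its digits equal to 0 from
-- position n on, so it is enough to run over the digits at positions
-- 0, …, n - 1. See f-counts, where the hypothesis 0 ∈ A is needed.

solutions : List ℕ → (n : ℕ) → List (Vec ℕ n)
solutions A n = filter (λ w → weight n (digits w) ≟ n) (words (elements A) n)

f : List ℕ → ℕ → ℕ
f A n = length (solutions A n)

n<2^n : ∀ n → n < 2 ^ n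
n<2^n zero    = z<s
n<2^n (suc n) = begin-strict
  suc n           <⟨ s<s (n<2^n n) ⟩
  1 + 2 ^ n       ≤⟨ +-monoˡ-≤ (2 ^ n) (m^n>0 2 n) ⟩
  2 ^ n + 2 ^ n   ≡⟨ cong (2 ^ n +_) (+-identityʳ (2 ^ n)) ⟨
  2 ^ suc n       ∎
  where open ≤-Reasoning

sum-cong : ∀ (g h : ℕ → ℕ) N → (∀ i → g i ≡ h i) →
           sum (applyUpTo g N) ≡ sum (applyUpTo h N)
sum-cong g h zero    eq = refl
sum-cong g h (suc N) eq = cong₂ _+_ (eq 0) (sum-cong (g ∘ suc) (h ∘ suc) N (eq ∘ suc))

sum-zero : ∀ (g : ℕ → ℕ) N → (∀ i → g i ≡ 0) → sum (applyUpTo g N) ≡ 0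
sum-zero g zero    eq = refl
sum-zero g (suc N) eq = cong₂ _+_ (eq 0) (sum-zero (g ∘ suc) N (eq ∘ suc))

sum-stable : ∀ (g : ℕ → ℕ) {M N} → M ≤ N → (∀ i → M ≤ i → g i ≡ 0) →
             sum (applyUpTo g N) ≡ sum (applyUpTo g M)
sum-stable g {N = N} z≤n eq = sum-zero g N (λ i → eq i z≤n)
sum-stable g (s≤s M≤N)   eq =
  cong (g 0 +_) (sum-stable (g ∘ suc) M≤N (λ i → eq (suc i) ∘ s≤s))

term≤sum : ∀ (g : ℕ → ℕ) {i N} → i < N → g i ≤ sum (applyUpTo g N)
term≤sum g {zero}  (s≤s _)   = m≤m+n (g 0) _
term≤sum g {suc i} (s≤s i<N) = ≤-trans (term≤sum (g ∘ suc) i<N) (m≤n+m _ (g 0))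

weight-stable : ∀ ε {M N} → M ≤ N → (∀ i → M ≤ i → ε i ≡ 0) → weight N ε ≡ weight M ε
weight-stable ε M≤N eq = sum-stable _ M≤N (λ i M≤i → cong (_* 2 ^ i) (eq i M≤i))

module _ {A n} (R : Representation A n) where

  ε≡0-beyond : ∀ i → n ≤ i → ε R i ≡ 0
  ε≡0-beyond i n≤i with bound R ≤? i
  ... | yes b≤i = ε≡0 R i b≤i
  ... | no  b≰i with ε R i in eq
  ...   | zero  = refl
  ...   | suc d = contradiction (begin-strict
    n                  <⟨ n<2^n n ⟩
    2 ^ n              ≤⟨ ^-monoʳ-≤ 2 n≤i ⟩
    2 ^ i              ≤⟨ m≤m+n (2 ^ i) (d * 2 ^ i) ⟩
    suc d * 2 ^ i      ≡⟨ cong (_* 2 ^ i) eq ⟨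
    ε R i * 2 ^ i      ≤⟨ term≤sum (λ j → ε R j * 2 ^ j) (≰⇒> b≰i) ⟩
    weight (bound R) (ε R) ≡⟨ value≡n R ⟩
    n                  ∎) (<-irrefl refl)
    where open ≤-Reasoning

  weight-n : weight n (ε R) ≡ n
  weight-n = begin
    weight n (ε R)             ≡⟨ weight-stable (ε R) (m≤m⊔n n (bound R)) ε≡0-beyond ⟨
    weight (n ⊔ bound R) (ε R) ≡⟨ weight-stable (ε R) (m≤n⊔m n (bound R)) (ε≡0 R) ⟩
    weight (bound R) (ε R)     ≡⟨ value≡n R ⟩
    n                          ∎
    where open ≡-Reasoning

prefix : ∀ k → (ℕ → ℕ) → Vec ℕ k
prefix zero    ε = []
prefix (suc k) ε = ε 0 ∷ prefix k (ε ∘ suc)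

digits-prefix : ∀ k ε → (∀ i → k ≤ i → ε i ≡ 0) → ∀ i → digits (prefix k ε) i ≡ ε i
digits-prefix zero    ε eq i       = sym (eq i z≤n)
digits-prefix (suc k) ε eq zero    = refl
digits-prefix (suc k) ε eq (suc i) = digits-prefix k (ε ∘ suc) (λ j → eq (suc j) ∘ s≤s) i

digits-beyond : ∀ {k} (w : Vec ℕ k) i → k ≤ i → digits w i ≡ 0
digits-beyond []      i       _         = refl
digits-beyond (a ∷ w) (suc i) (s≤s k≤i) = digits-beyond w i k≤i

digits-injective : ∀ {k} (v w : Vec ℕ k) → (∀ i → digits v i ≡ digits w i) → v ≡ w
digits-injective []      []      eq = refl
digits-injective (a ∷ v) (b ∷ w) eq = cong₂ _∷_ (eq 0) (digits-injective v w (eq ∘ suc))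

prefix∈words : ∀ {A} k ε → (∀ i → ε i ∈ A) → prefix k ε ∈ words A k
prefix∈words zero    ε ε∈ = here refl
prefix∈words (suc k) ε ε∈ =
  ∈-cartesianProductWith⁺ _∷_ (ε∈ 0) (prefix∈words k (ε ∘ suc) (ε∈ ∘ suc))

digits∈ : ∀ {A} → 0 ∈ A → ∀ {k} (w : Vec ℕ k) → w ∈ words A k → ∀ i → digits w i ∈ A
digits∈ 0∈A []      _  i = 0∈A
digits∈ {A} 0∈A {suc k} (a ∷ w) w∈ i
  with ∈-cartesianProductWith⁻ _∷_ A (words A k) w∈
digits∈ 0∈A (a ∷ w) w∈ zero    | _ , _ , a∈ , _  , refl = a∈
digits∈ 0∈A (a ∷ w) w∈ (suc i) | _ , _ , _  , w∈′ , refl = digits∈ 0∈A w w∈′ i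

words-unique : ∀ {A} → Unique A → ∀ k → Unique (words A k)
words-unique A! zero    = All.[] ∷ []
words-unique A! (suc k) =
  Unique.cartesianProductWith⁺ _∷_ ∷-injective A! (words-unique A! k)

lookup-injective : ∀ {X : Set} {xs : List X} → Unique xs →
                   ∀ i j → lookup xs i ≡ lookup xs j → i ≡ j
lookup-injective (_ ∷ _)   Fin.zero    Fin.zero    _  = refl
lookup-injective (x∉ ∷ _)  Fin.zero    (Fin.suc j) eq = contradiction eq (All.lookup x∉ (∈-lookup j))
lookup-injective (x∉ ∷ _)  (Fin.suc i) Fin.zero    eq = contradiction (sym eq) (All.lookup x∉ (∈-lookup i))
lookup-injective (_ ∷ xs!) (Fin.suc i) (Fin.suc j) eq = cong Fin.suc (lookup-injective xs! i j eq)

f-counts : ∀ A → 0 ∈ A → ∀ n → Bijection (setoid (Fin (f A n))) (representations A n)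
f-counts A 0∈A n = record
  { to        = rep
  ; cong      = λ { refl i → refl }
  ; bijective =
      (λ {i} {j} eq → lookup-injective unique i j (digits-injective _ _ eq))
    , (λ R → index (member R) , λ { refl i →
         trans (cong (λ w → digits w i) (sym (lookup-index (member R))))
               (digits-prefix n (ε R) (ε≡0-beyond R) i) })
  }
  where
  P? = λ (w : Vec ℕ n) → weight n (digits w) ≟ n

  0∈elements : 0 ∈ elements A
  0∈elements = ∈-deduplicate⁺ _≟_ 0∈A

  unique : Unique (solutions A n)
  unique = Unique.filter⁺ P? (words-unique (deduplicate-! _≟_ A) n)

  rep : Fin (f A n) → Representation A n
  rep i = record
    { ε       = digits w
    ; ε∈A     = λ j → ∈-deduplicate⁻ _≟_ A (digits∈ 0∈elements w (proj₁ w∈) j)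
    ; bound   = n
    ; ε≡0     = digits-beyond w
    ; value≡n = proj₂ w∈
    }
    where
    w  = lookup (solutions A n) i
    w∈ = ∈-filter⁻ P? {xs = words (elements A) n} (∈-lookup i)

  member : (R : Representation A n) → prefix n (ε R) ∈ solutions A n
  member R = ∈-filter⁺ P?
    (prefix∈words n (ε R) (λ i → ∈-deduplicate⁺ _≟_ (ε∈A R i)))
    (trans (sum-cong _ _ n (λ i → cong (_* 2 ^ i) (digits-prefix n (ε R) (ε≡0-beyond R) i)))
           (weight-n R))

-- 𝔽₂ is Parity, and an element of 𝔽₂[x] is a list of coefficients, constant
-- term first, up to trailing zeros.

𝔽₂[x] : Set
𝔽₂[x] = List Parity

coeff : 𝔽₂[x] → ℕ → Parity
coeff []      i       = 0ℙ
coeff (c ∷ p) zero    = c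
coeff (c ∷ p) (suc i) = coeff p i

infixl 6 _⊕_
infixl 7 _⊛_

_⊕_ : 𝔽₂[x] → 𝔽₂[x] → 𝔽₂[x]
[]      ⊕ q       = q
(c ∷ p) ⊕ []      = c ∷ p
(c ∷ p) ⊕ (d ∷ q) = c ℙ.+ d ∷ p ⊕ q

_⊛_ : 𝔽₂[x] → 𝔽₂[x] → 𝔽₂[x]
[]      ⊛ q = []
(c ∷ p) ⊛ q = map (c ℙ.*_) q ⊕ (0ℙ ∷ p ⊛ q)

𝔽₂[x]-rawSemiring : RawSemiring 0ℓ 0ℓ
𝔽₂[x]-rawSemiring = record
  { Carrier = 𝔽₂[x]
  ; _≈_     = λ p q → ∀ i → coeff p i ≡ coeff q i
  ; _+_     = _⊕_
  ; _*_     = _⊛_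
  ; 0#      = []
  ; 1#      = 1ℙ ∷ []
  }

open RawSemiring 𝔽₂[x]-rawSemiring public
  using () renaming (_≈_ to _≈ₚ_; 0# to 0ₚ; 1# to 1ₚ)
open RawSemiringDefinitions 𝔽₂[x]-rawSemiring public
  using () renaming (_^_ to _^ₚ_)

X : 𝔽₂[x]
X = 0ℙ ∷ 1ℙ ∷ []

φ : List ℕ → 𝔽₂[x]
φ A = foldr (λ a p → X ^ₚ a ⊕ p) 0ₚ (elements A)

IsPeriod : (ℕ → ℕ) → ℕ → Set
IsPeriod s p = 0 < p × (∀ n → s (n + p) ≡ s n)

IsLeastPeriod : (ℕ → ℕ) → ℕ → Set
IsLeastPeriod s p = IsPeriod s p × (∀ q → IsPeriod s q → p ≤ q)

occurrences : (ℕ → ℕ) → ℕ → ℕ → ℕ → ℕ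
occurrences s v m N = length (filter (λ i → s (m + i) ≟ v) (upTo N))

{-# OPTIONS --safe #-}
module Submission where

-- Modulo 2, the generating function of f (𝒜 r) satisfies F(x) = φ(x) F(x²) = φ(x) F(x)²,
-- so F = 1/φ. With q = 2ʳ, φ = (1 + x)(1 + x^(q-1) + x^q), and partial fractions turn F φ = 1 into
-- s(n) + s(n-q+1) + s(n-q) = 1 for s = f mod 2, where s vanishes on negative arguments. The
-- complement C(n) = 1 + s(n-q) then satisfies C(n+q) = C(n) + C(n+1), and C(n) = 1 for n < q.
-- Writing S for the shift, S^q = 1 + S gives S^(q²) = (1 + S)^q = 1 + S^q = S, that is, the
-- period q² - 1. Cut into rows of length q and read backwards, C is a Pascal triangle modulo 2,
-- which has 3ʳ ones among its first q rows.

open import Defs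
open import Data.Nat using (ℕ; _≤_; _+_; _∸_; _^_; _%_)
open import Data.Nat.Divisibility using (_∣_)
open import Data.Product using (_×_; ∃-syntax)
open import Relation.Binary.PropositionalEquality using (_≡_)

open import Data.List.Base
  using (List; []; _∷_; _++_; length; filter; map; foldr; applyUpTo; deduplicate; cartesianProductWith)
open import Data.List.Properties using (filter-≐; filter-++; length-++; filter-none; filter-all)
import Data.List.Relation.Unary.All as All
open import Data.List.Relation.Unary.AllPairs using ([]; _∷_)
open import Data.List.Relation.Unary.Unique.Propositional using (Unique)
open import Data.Nat.Base
  using (zero; suc; pred; _*_; _<_; _/_; z≤n; s≤s; z<s; s<s; parity; >-nonZero; 2+)
open import Data.Nat.Divisibility using (m%n≡0⇒n∣m)
open import Data.Nat.DivMod using (m≡m%n+[m/n]*n; m%n<n; [m+n]%n≡m%n)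
open import Data.Nat.Induction using (<-rec)
open import Data.Nat.ListAction using (sum)
open import Data.Nat.Properties
open import Data.Nat.Tactic.RingSolver using (solve-∀)
open import Data.Parity.Base as ℙ using (Parity; 0ℙ; 1ℙ; _⁻¹)
import Data.Parity.Properties as ℙ
open import Data.Product.Base using (_,_; proj₁; proj₂)
open import Data.Vec.Base using (Vec; []; _∷_)
open import Function.Base using (_∘_)
open import Level using (0ℓ)
open import Relation.Binary.PropositionalEquality
  using (_≢_; refl; sym; trans; cong; cong₂; subst; module ≡-Reasoning)
open import Relation.Nullary.Decidable.Core using (Dec; yes; no; ¬?)
open import Relation.Nullary.Decidable using (map′; _×-dec_)
open import Relation.Nullary.Negation using (¬_)
open import Relation.Unary using (Pred; Decidable)

-- Counting modulo 2

count : ∀ {A : Set} {P : Pred A 0ℓ} → Decidable P → List A → Parity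
count P? xs = parity (length (filter P? xs))

module _ {A : Set} {P : Pred A 0ℓ} (P? : Decidable P) where

  count-++ : ∀ xs ys → count P? (xs ++ ys) ≡ count P? xs ℙ.+ count P? ys
  count-++ xs ys = begin
    parity (length (filter P? (xs ++ ys)))           ≡⟨ cong (parity ∘ length) (filter-++ P? xs ys) ⟩
    parity (length (filter P? xs ++ filter P? ys))   ≡⟨ cong parity (length-++ (filter P? xs)) ⟩
    parity (length (filter P? xs) + length (filter P? ys)) ≡⟨ ℙ.+-homo-+ (length (filter P? xs)) _ ⟩
    count P? xs ℙ.+ count P? ys                      ∎
    where open ≡-Reasoning

  length-filter-map : ∀ {B : Set} (h : B → A) xs →
                      length (filter P? (map h xs)) ≡ length (filter (P? ∘ h) xs)
  length-filter-map h []       = refl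
  length-filter-map h (x ∷ xs) with P? (h x)
  ... | yes _ = cong suc (length-filter-map h xs)
  ... | no  _ = length-filter-map h xs

  count-none : ∀ xs → (∀ x → ¬ P x) → count P? xs ≡ 0ℙ
  count-none xs ¬P = cong (parity ∘ length) (filter-none P? (All.universal ¬P xs))

  count-cong : ∀ {Q : Pred A 0ℓ} (Q? : Decidable Q) xs →
               (∀ {x} → P x → Q x) → (∀ {x} → Q x → P x) → count P? xs ≡ count Q? xs
  count-cong Q? xs P⇒Q Q⇒P = cong (parity ∘ length) (filter-≐ P? Q? (P⇒Q , Q⇒P) xs)

-- Even and odd numbers, and splitting off the lowest digit

*2-injective : ∀ {m n} → m * 2 ≡ n * 2 → m ≡ n
*2-injective = *-cancelʳ-≡ _ _ 2

m*2≢1+n*2 : ∀ m n → m * 2 ≢ suc (n * 2)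
m*2≢1+n*2 (suc m) (suc n) eq = m*2≢1+n*2 m n (suc-injective (suc-injective eq))

data EvenOrOdd : ℕ → Set where
  even : ∀ m → EvenOrOdd (m * 2)
  odd  : ∀ m → EvenOrOdd (suc (m * 2))

evenOrOdd : ∀ n → EvenOrOdd n
evenOrOdd zero = even 0
evenOrOdd (suc n) with evenOrOdd n
... | even m = odd m
... | odd  m = even (suc m)

n<2^k⇒n≡0 : ∀ {n} → n < 2 ^ 0 → n ≡ 0
n<2^k⇒n≡0 (s≤s z≤n) = refl

-- This is F(x) = φ(x) F(x²) on the level of words: behind the lowest digit, every power of 2
-- carries a further factor 2.
weight-∷ : ∀ {k} a (w : Vec ℕ k) →
           weight (suc k) (digits (a ∷ w)) ≡ a + weight k (digits w) * 2
weight-∷ {k} a w = cong₂ _+_ (*-identityʳ a) (sum-double (digits w) (2 ^_) k)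
  where
  double-term : ∀ a b → a * (2 * b) ≡ a * b * 2
  double-term = solve-∀
  sum-double : ∀ (e c : ℕ → ℕ) k →
    sum (applyUpTo (λ i → e i * (2 * c i)) k) ≡ sum (applyUpTo (λ i → e i * c i) k) * 2
  sum-double e c zero    = refl
  sum-double e c (suc k) = begin
    e 0 * (2 * c 0) + _  ≡⟨ cong₂ _+_ (double-term (e 0) (c 0)) (sum-double (e ∘ suc) (c ∘ suc) k) ⟩
    e 0 * c 0 * 2 + _    ≡⟨ *-distribʳ-+ 2 (e 0 * c 0) _ ⟨
    _                    ∎
    where open ≡-Reasoning

-- The parity of the number of representations

module Digits (t : ℕ) where

  -- For t = 2ʳ⁻¹ - 1 this is 2ʳ, in a form that makes `q` visibly even and the digits q - 1 and q +
  -- 1 visibly odd.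
  q : ℕ
  q = suc t * 2

  E : List ℕ
  E = 0 ∷ 1 ∷ suc (t * 2) ∷ suc q ∷ []

  -- The shift x makes this f (y - x) modulo 2 (for k large), with value 0 at negative arguments.
  hits : ℕ → ℕ → ℕ → Parity
  hits k x y = count (λ w → x + weight k (digits w) ≟ y) (words E k)

  -- What remains of `hits` once the lowest digit has been absorbed into x: the higher digits enter
  -- with doubled weight.
  halfHits : ℕ → ℕ → ℕ → Parity
  halfHits k x y = count (λ (w : Vec ℕ k) → x + weight k (digits w) * 2 ≟ y) (words E k)

  hits-< : ∀ k {x y} → y < x → hits k x y ≡ 0ℙ
  hits-< k {x} {y} y<x = count-none _ (words E k)
    λ w eq → <⇒≱ y<x (subst (x ≤_) eq (m≤m+n x _))

  hits-shift : ∀ k c x y → hits k (x + c) (y + c) ≡ hits k x y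
  hits-shift k c x y = count-cong _ _ (words E k)
    (λ {w} eq → +-cancelʳ-≡ c _ _ (trans (swap x (weight k (digits w)) c) eq))
    (λ {w} eq → trans (sym (swap x (weight k (digits w)) c)) (cong (_+ c) eq))
    where
    swap : ∀ x v c → x + v + c ≡ x + c + v
    swap = solve-∀

  -- Doubled weights preserve the parity of x, so solutions require x and y of equal parity, and
  -- then the equation can be halved. The next three lemmas are the other cases.
  halfHits-even-even : ∀ k x y → halfHits k (x * 2) (y * 2) ≡ hits k x y
  halfHits-even-even k x y = count-cong _ _ (words E k)
    (λ {w} eq → *2-injective (trans (*-distribʳ-+ 2 x (weight k (digits w))) eq))
    (λ {w} eq → trans (sym (*-distribʳ-+ 2 x (weight k (digits w)))) (cong (_* 2) eq))

  halfHits-odd-odd : ∀ k x y → halfHits k (suc (x * 2)) (suc (y * 2)) ≡ hits k x y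
  halfHits-odd-odd k x y = trans
    (count-cong _ _ (words E k) suc-injective (cong suc))
    (halfHits-even-even k x y)

  halfHits-even-odd : ∀ k x y → halfHits k (x * 2) (suc (y * 2)) ≡ 0ℙ
  halfHits-even-odd k x y = count-none _ (words E k) λ w eq →
    m*2≢1+n*2 (x + weight k (digits w)) y (trans (*-distribʳ-+ 2 x (weight k (digits w))) eq)

  halfHits-odd-even : ∀ k x y → halfHits k (suc (x * 2)) (y * 2) ≡ 0ℙ
  halfHits-odd-even k x y = count-none _ (words E k) λ w eq →
    m*2≢1+n*2 y (x + weight k (digits w)) (trans (sym eq) (cong suc (sym (*-distribʳ-+ 2 x (weight k (digits w))))))

  -- One summand for each lowest digit 0, 1, q - 1, q + 1.
  hits-suc : ∀ k x y → hits (suc k) x y ≡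
    halfHits k x y ℙ.+ (halfHits k (suc x) y ℙ.+
      (halfHits k (suc (x + t * 2)) y ℙ.+ halfHits k (suc (x + q)) y))
  hits-suc k x y = begin
    hits (suc k) x y
      ≡⟨ split 0 (1 ∷ suc (t * 2) ∷ suc q ∷ []) ⟩
    block 0 ℙ.+ _
      ≡⟨ cong (block 0 ℙ.+_) (split 1 (suc (t * 2) ∷ suc q ∷ [])) ⟩
    block 0 ℙ.+ (block 1 ℙ.+ _)
      ≡⟨ cong (λ p → block 0 ℙ.+ (block 1 ℙ.+ p)) (split (suc (t * 2)) (suc q ∷ [])) ⟩
    block 0 ℙ.+ (block 1 ℙ.+ (block (suc (t * 2)) ℙ.+ _))
      ≡⟨ cong (λ p → block 0 ℙ.+ (block 1 ℙ.+ (block (suc (t * 2)) ℙ.+ p)))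
           (trans (split (suc q) []) (ℙ.+-identityʳ _)) ⟩
    block 0 ℙ.+ (block 1 ℙ.+ (block (suc (t * 2)) ℙ.+ block (suc q)))
      ≡⟨ cong₂ ℙ._+_ (at (+-identityʳ x)) (cong₂ ℙ._+_ (at (+-comm x 1))
           (cong₂ ℙ._+_ (at (+-suc x (t * 2))) (at (+-suc x q)))) ⟩
    _ ∎
    where
    open ≡-Reasoning
    block : ℕ → Parity
    block a = halfHits k (x + a) y
    at : ∀ {a b} → a ≡ b → halfHits k a y ≡ halfHits k b y
    at = cong (λ z → halfHits k z y)
    P? : (w : Vec ℕ (suc k)) → Dec (x + weight (suc k) (digits w) ≡ y)
    P? w = x + weight (suc k) (digits w) ≟ y
    weight-eq : ∀ a (w : Vec ℕ k) →
                x + weight (suc k) (digits (a ∷ w)) ≡ x + a + weight k (digits w) * 2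
    weight-eq a w = trans (cong (x +_) (weight-∷ a w)) (sym (+-assoc x a _))
    split : ∀ a as → count P? (cartesianProductWith _∷_ (a ∷ as) (words E k)) ≡
                     block a ℙ.+ count P? (cartesianProductWith _∷_ as (words E k))
    split a as = trans
      (count-++ P? (map (a ∷_) (words E k)) _)
      (cong (ℙ._+ count P? (cartesianProductWith _∷_ as (words E k))) (trans
        (cong parity (length-filter-map P? (a ∷_) (words E k)))
        (count-cong _ _ (words E k)
          (λ {w} → trans (sym (weight-eq a w)))
          (λ {w} → trans (weight-eq a w)))))

  -- Only the digit 0 is even, so an even difference y - x forces it, while an odd one leaves the
  -- three odd digits. In terms of f, here and in the next three lemmas: f(2n) = f(n) and f(2n+1) =
  -- f(n) + f(n-q/2+1) + f(n-q/2).
  hits-even-even : ∀ k x y → hits (suc k) (x * 2) (y * 2) ≡ hits k x y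
  hits-even-even k x y
    rewrite hits-suc k (x * 2) (y * 2)
          | sym (*-distribʳ-+ 2 x t) | sym (*-distribʳ-+ 2 x (suc t))
          | halfHits-even-even k x y | halfHits-odd-even k x y
          | halfHits-odd-even k (x + t) y | halfHits-odd-even k (x + suc t) y
          = ℙ.+-identityʳ _

  hits-odd-odd : ∀ k x y → hits (suc k) (suc (x * 2)) (suc (y * 2)) ≡ hits k x y
  hits-odd-odd k x y
    rewrite hits-suc k (suc (x * 2)) (suc (y * 2))
          | sym (*-distribʳ-+ 2 x t) | sym (*-distribʳ-+ 2 x (suc t))
          | halfHits-odd-odd k x y | halfHits-even-odd k (suc x) y
          | halfHits-even-odd k (suc (x + t)) y | halfHits-even-odd k (suc (x + suc t)) y
          = ℙ.+-identityʳ _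

  hits-odd-even : ∀ k x y → hits (suc k) (suc (x * 2)) (y * 2) ≡
    hits k (suc x) y ℙ.+ (hits k (suc (x + t)) y ℙ.+ hits k (suc (x + suc t)) y)
  hits-odd-even k x y
    rewrite hits-suc k (suc (x * 2)) (y * 2)
          | sym (*-distribʳ-+ 2 x t) | sym (*-distribʳ-+ 2 x (suc t))
          | halfHits-odd-even k x y | halfHits-even-even k (suc x) y
          | halfHits-even-even k (suc (x + t)) y | halfHits-even-even k (suc (x + suc t)) y
          = refl

  hits-even-odd : ∀ k x y → hits (suc k) (x * 2) (suc (y * 2)) ≡
    hits k x y ℙ.+ (hits k (x + t) y ℙ.+ hits k (x + suc t) y)
  hits-even-odd k x y
    rewrite hits-suc k (x * 2) (suc (y * 2))
          | sym (*-distribʳ-+ 2 x t) | sym (*-distribʳ-+ 2 x (suc t))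
          | halfHits-even-odd k x y | halfHits-odd-odd k x y
          | halfHits-odd-odd k (x + t) y | halfHits-odd-odd k (x + suc t) y
          = refl

  -- f(n) + f(n-q+1) + f(n-q); it depends only on ⌊ n / 2 ⌋, hence equals f(0) = 1.
  tripleHits : ℕ → ℕ → Parity
  tripleHits k n = hits k 0 n ℙ.+ (hits k (suc (t * 2)) n ℙ.+ hits k q n)

  cancel-outer : ∀ v a b c → v ℙ.+ ((a ℙ.+ (b ℙ.+ c)) ℙ.+ a) ≡ v ℙ.+ (b ℙ.+ c)
  cancel-outer v a b c = cong (v ℙ.+_) (begin
    a ℙ.+ (b ℙ.+ c) ℙ.+ a   ≡⟨ ℙ.+-comm (a ℙ.+ (b ℙ.+ c)) a ⟩
    a ℙ.+ (a ℙ.+ (b ℙ.+ c)) ≡⟨ ℙ.+-assoc a a (b ℙ.+ c) ⟨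
    a ℙ.+ a ℙ.+ (b ℙ.+ c)   ≡⟨ cong (ℙ._+ (b ℙ.+ c)) (ℙ.p+p≡0ℙ a) ⟩
    b ℙ.+ c                 ∎)
    where open ≡-Reasoning

  cancel-inner : ∀ v a b c → (v ℙ.+ (a ℙ.+ b)) ℙ.+ (a ℙ.+ (b ℙ.+ c)) ≡ v ℙ.+ c
  cancel-inner v a b c = begin
    (v ℙ.+ (a ℙ.+ b)) ℙ.+ (a ℙ.+ (b ℙ.+ c))  ≡⟨ cong (v ℙ.+ (a ℙ.+ b) ℙ.+_) (ℙ.+-assoc a b c) ⟨
    (v ℙ.+ (a ℙ.+ b)) ℙ.+ ((a ℙ.+ b) ℙ.+ c)  ≡⟨ ℙ.+-assoc v (a ℙ.+ b) _ ⟩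
    v ℙ.+ ((a ℙ.+ b) ℙ.+ ((a ℙ.+ b) ℙ.+ c))  ≡⟨ cong (v ℙ.+_) (ℙ.+-assoc (a ℙ.+ b) (a ℙ.+ b) c) ⟨
    v ℙ.+ (((a ℙ.+ b) ℙ.+ (a ℙ.+ b)) ℙ.+ c)  ≡⟨ cong (λ p → v ℙ.+ (p ℙ.+ c)) (ℙ.p+p≡0ℙ (a ℙ.+ b)) ⟩
    v ℙ.+ c                                  ∎
    where open ≡-Reasoning

  t+t : t + t ≡ t * 2
  t+t = sym (trans (*-comm t 2) (cong (t +_) (+-identityʳ t)))

  -- Since f(2n-q+1) = f(n-q/2) + f(n-q+1) + f(n-q) and f(2n-q) = f(n-q/2), the term f(n-q/2) occurs
  -- twice and cancels.
  tripleHits-even : ∀ k n → tripleHits (suc k) (n * 2) ≡ tripleHits k n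
  tripleHits-even k n rewrite hits-even-even k 0 n | hits-odd-even k t n | hits-even-even k (suc t) n
                   | +-suc t t | t+t =
    cancel-outer (hits k 0 n) (hits k (suc t) n) (hits k (suc (t * 2)) n) (hits k q n)

  -- Both f(n-q/2+1) and f(n-q/2) occur in f(2n+1); the first is also f(2n-q+2), the second also a
  -- term of f(2n+1-q), so both cancel.
  tripleHits-odd : ∀ k n → tripleHits (suc k) (suc (n * 2)) ≡ tripleHits k n
  tripleHits-odd k n rewrite hits-even-odd k 0 n | hits-odd-odd k t n | hits-even-odd k (suc t) n
                  | +-suc t t | t+t =
    cancel-inner (hits k 0 n) (hits k t n) (hits k (suc t) n) (hits k (suc (t * 2)) n ℙ.+ hits k q n)

  -- The bound lets k halvings bring n down to 0, where the arguments 1 - q and -q are negative and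
  -- only f(0) is left.
  tripleHits≡1 : ∀ k n → n < 2 ^ k → tripleHits k n ≡ 1ℙ
  tripleHits≡1 zero n n<1 rewrite n<2^k⇒n≡0 n<1 = refl
  tripleHits≡1 (suc k) n n<2^k with evenOrOdd n
  ... | even m = trans (tripleHits-even k m) (tripleHits≡1 k m
          (*-cancelʳ-< 2 m (2 ^ k) (subst (m * 2 <_) (*-comm 2 (2 ^ k)) n<2^k)))
  ... | odd  m = trans (tripleHits-odd k m) (tripleHits≡1 k m
          (*-cancelʳ-< 2 m (2 ^ k) (subst (m * 2 <_) (*-comm 2 (2 ^ k)) (<-trans (n<1+n _) n<2^k))))

  -- 1 + f(n-q), where f(n-q) = 0 for n < q.
  C : ℕ → Parity
  C n = 1ℙ ℙ.+ hits n q n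

  -- Words of different lengths are not compared directly. By `tripleHits≡1` the values at n-q+1 and
  -- n-q determine the one at n; both arguments are smaller than n, so strong induction applies.
  hits-stable : ∀ n k l → n < 2 ^ k → n < 2 ^ l → hits k 0 n ≡ hits l 0 n
  hits-stable = <-rec _ step
    where
    P : ℕ → Set
    P n = ∀ k l → n < 2 ^ k → n < 2 ^ l → hits k 0 n ≡ hits l 0 n

    step : ∀ n → (∀ {m} → m < n → P m) → P n
    step n rec k l n<2^k n<2^l = ℙ.+-cancelʳ-≡ _ _ _ (begin
      hits k 0 n ℙ.+ (hits k (suc (t * 2)) n ℙ.+ hits k q n)
        ≡⟨ tripleHits≡1 k n n<2^k ⟩
      1ℙ
        ≡⟨ tripleHits≡1 l n n<2^l ⟨
      hits l 0 n ℙ.+ (hits l (suc (t * 2)) n ℙ.+ hits l q n)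
        ≡⟨ cong (hits l 0 n ℙ.+_) (cong₂ ℙ._+_ (agree (t * 2)) (agree (suc (t * 2)))) ⟨
      hits l 0 n ℙ.+ (hits k (suc (t * 2)) n ℙ.+ hits k q n)
        ∎)
      where
      open ≡-Reasoning
      agree : ∀ x → hits k (suc x) n ≡ hits l (suc x) n
      agree x with n <? suc x
      ... | yes n<1+x = trans (hits-< k n<1+x) (sym (hits-< l n<1+x))
      ... | no  n≮1+x = subst (λ m → hits k (suc x) m ≡ hits l (suc x) m)
        (m∸n+n≡m (≮⇒≥ n≮1+x))
        (trans (hits-shift k (suc x) 0 d) (trans
          (rec d<n k l (<-trans d<n n<2^k) (<-trans d<n n<2^l))
          (sym (hits-shift l (suc x) 0 d))))
        where
        d = n ∸ suc x
        d<n : d < n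
        d<n = ∸-monoʳ-< {n} z<s (≮⇒≥ n≮1+x)

  hits-stable-shift : ∀ n x k l → n < 2 ^ k → n < 2 ^ l → hits k x n ≡ hits l x n
  hits-stable-shift n x k l n<2^k n<2^l with n <? x
  ... | yes n<x = trans (hits-< k n<x) (sym (hits-< l n<x))
  ... | no  n≮x = subst (λ m → hits k x m ≡ hits l x m)
        (m∸n+n≡m (≮⇒≥ n≮x))
        (trans (hits-shift k x 0 d) (trans
          (hits-stable d k l (≤-<-trans (m∸n≤m n x) n<2^k) (≤-<-trans (m∸n≤m n x) n<2^l))
          (sym (hits-shift l x 0 d))))
    where d = n ∸ x

  C-init : ∀ {n} → n < q → C n ≡ 1ℙ
  C-init {n} n<q = cong (1ℙ ℙ.+_) (hits-< n n<q)

  hits≡C : ∀ n → hits n 0 n ≡ 1ℙ ℙ.+ C (n + q)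
  hits≡C n = begin
    hits n 0 n                    ≡⟨ hits-stable n n (n + q) (n<2^n n) n<2^[n+q] ⟩
    hits (n + q) 0 n              ≡⟨ hits-shift (n + q) q 0 n ⟨
    hits (n + q) q (n + q)        ≡⟨ ℙ.⁻¹-involutive _ ⟨
    1ℙ ℙ.+ C (n + q)              ∎
    where
    open ≡-Reasoning
    n<2^[n+q] : n < 2 ^ (n + q)
    n<2^[n+q] = ≤-<-trans (m≤m+n n q) (n<2^n (n + q))

  -- From `tripleHits≡1`, 1 + f(n) = f(n-q) + f(n-q+1), and complementing both summands on the right
  -- changes nothing. Passing to complements thus makes the recurrence homogeneous.
  C-rec : ∀ n → C (n + q) ≡ C n ℙ.+ C (suc n)
  C-rec n = begin
    C (n + q)
      ≡⟨ ℙ.⁻¹-involutive _ ⟨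
    1ℙ ℙ.+ (1ℙ ℙ.+ C (n + q))
      ≡⟨ cong (1ℙ ℙ.+_) (hits≡C n) ⟨
    1ℙ ℙ.+ hits n 0 n
      ≡⟨ solve-for (hits n 0 n) (hits n (suc (t * 2)) n) (hits n q n) (tripleHits≡1 n n (n<2^n n)) ⟩
    (1ℙ ℙ.+ hits n q n) ℙ.+ (1ℙ ℙ.+ hits n (suc (t * 2)) n)
      ≡⟨ cong (λ p → C n ℙ.+ (1ℙ ℙ.+ p)) (begin
           hits n (suc (t * 2)) n        ≡⟨ hits-stable-shift n _ n (suc n) (n<2^n n) (<-trans (n<1+n n) (n<2^n (suc n))) ⟩
           hits (suc n) (suc (t * 2)) n  ≡⟨ hits-suc-suc (suc n) (suc (t * 2)) n ⟨
           hits (suc n) q (suc n)        ∎) ⟩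
    C n ℙ.+ C (suc n) ∎
    where
    open ≡-Reasoning
    solve-for : ∀ a b c → a ℙ.+ (b ℙ.+ c) ≡ 1ℙ → 1ℙ ℙ.+ a ≡ (1ℙ ℙ.+ c) ℙ.+ (1ℙ ℙ.+ b)
    solve-for 0ℙ 0ℙ 1ℙ _ = refl
    solve-for 0ℙ 1ℙ 0ℙ _ = refl
    solve-for 1ℙ 0ℙ 0ℙ _ = refl
    solve-for 1ℙ 1ℙ 1ℙ _ = refl
    hits-suc-suc : ∀ k x y → hits k (suc x) (suc y) ≡ hits k x y
    hits-suc-suc k x y = count-cong _ _ (words E k) suc-injective (cong suc)

-- Finite sums

Σ< : ℕ → (ℕ → ℕ) → ℕ
Σ< n g = sum (applyUpTo g n)

Σ<-cong : ∀ {g h} n → (∀ i → i < n → g i ≡ h i) → Σ< n g ≡ Σ< n h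
Σ<-cong zero    g≡h = refl
Σ<-cong (suc n) g≡h = cong₂ _+_ (g≡h 0 z<s) (Σ<-cong n (λ i → g≡h (suc i) ∘ s<s))

Σ<-+ : ∀ g h n → Σ< n (λ i → g i + h i) ≡ Σ< n g + Σ< n h
Σ<-+ g h zero    = refl
Σ<-+ g h (suc n) = trans (cong (g 0 + h 0 +_) (Σ<-+ (g ∘ suc) (h ∘ suc) n))
                         (interchange (g 0) (h 0) (Σ< n (g ∘ suc)) (Σ< n (h ∘ suc)))
  where
  interchange : ∀ a b c d → a + b + (c + d) ≡ a + c + (b + d)
  interchange = solve-∀

Σ<-last : ∀ g n → Σ< (suc n) g ≡ Σ< n g + g n
Σ<-last g zero    = +-identityʳ (g 0)
Σ<-last g (suc n) = trans (cong (g 0 +_) (Σ<-last (g ∘ suc) n)) (sym (+-assoc (g 0) _ _))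

Σ<-reverse : ∀ g n → Σ< n g ≡ Σ< n (λ i → g (n ∸ suc i))
Σ<-reverse g zero    = refl
Σ<-reverse g (suc n) = begin
  Σ< (suc n) g                         ≡⟨ Σ<-last g n ⟩
  Σ< n g + g n                         ≡⟨ +-comm (Σ< n g) (g n) ⟩
  g n + Σ< n g                         ≡⟨ cong (g n +_) (Σ<-reverse g n) ⟩
  g n + Σ< n (λ i → g (n ∸ suc i))     ∎
  where open ≡-Reasoning

Σ<-1 : ∀ n → Σ< n (λ _ → 1) ≡ n
Σ<-1 zero    = refl
Σ<-1 (suc n) = cong suc (Σ<-1 n)

Σ<-double : ∀ g n → Σ< (n * 2) g ≡ Σ< n (λ i → g (i * 2) + g (suc (i * 2)))
Σ<-double g zero    = refl
Σ<-double g (suc n) = trans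
  (cong (λ s → g 0 + (g 1 + s)) (Σ<-double (g ∘ suc ∘ suc) n))
  (sym (+-assoc (g 0) (g 1) _))

Σ<-append : ∀ g m n → Σ< (m + n) g ≡ Σ< m g + Σ< n (λ i → g (m + i))
Σ<-append g zero    n = refl
Σ<-append g (suc m) n = trans (cong (g 0 +_) (Σ<-append (g ∘ suc) m n)) (sym (+-assoc (g 0) _ _))

Σ<-* : ∀ g m n → Σ< (m * n) g ≡ Σ< m (λ b → Σ< n (λ a → g (a + b * n)))
Σ<-* g zero    n = refl
Σ<-* g (suc m) n = begin
  Σ< (n + m * n) g
    ≡⟨ Σ<-append g n (m * n) ⟩
  Σ< n g + Σ< (m * n) (λ i → g (n + i))
    ≡⟨ cong₂ _+_ (Σ<-cong n (λ a _ → cong g (sym (+-identityʳ a)))) (Σ<-* (g ∘ (n +_)) m n) ⟩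
  Σ< n (λ a → g (a + 0)) + Σ< m (λ b → Σ< n (λ a → g (n + (a + b * n))))
    ≡⟨ cong (Σ< n (λ a → g (a + 0)) +_)
         (Σ<-cong m (λ b _ → Σ<-cong n (λ a _ → cong g (swap n a (b * n))))) ⟩
  Σ< n (λ a → g (a + 0)) + Σ< m (λ b → Σ< n (λ a → g (a + (n + b * n)))) ∎
  where
  open ≡-Reasoning
  swap : ∀ x y z → x + (y + z) ≡ y + (x + z)
  swap = solve-∀

Σ<-rotate : ∀ g n → g n ≡ g 0 → Σ< n (g ∘ suc) ≡ Σ< n g
Σ<-rotate g n gn≡g0 = +-cancelˡ-≡ (g 0) _ _ (begin
  Σ< (suc n) g   ≡⟨ Σ<-last g n ⟩
  Σ< n g + g n   ≡⟨ cong (Σ< n g +_) gn≡g0 ⟩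
  Σ< n g + g 0   ≡⟨ +-comm (Σ< n g) (g 0) ⟩
  g 0 + Σ< n g   ∎)
  where open ≡-Reasoning

Σ<-period : ∀ g n → (∀ i → g (i + n) ≡ g i) → ∀ m → Σ< n (λ i → g (m + i)) ≡ Σ< n g
Σ<-period g n per zero    = refl
Σ<-period g n per (suc m) = trans
  (Σ<-cong n (λ i _ → cong g (sym (+-suc m i))))
  (trans (Σ<-rotate (g ∘ (m +_)) n (trans (per m) (cong g (sym (+-identityʳ m)))))
         (Σ<-period g n per m))

-- Pascal's triangle modulo 2

value : Parity → ℕ
value 0ℙ = 0
value 1ℙ = 1

-- T b a is the coefficient of xᵃ in (1 + x)ᵇ⁻¹ over 𝔽₂, where (1 + x)⁻¹ = 1 + x + x² + ⋯.
T : ℕ → ℕ → Parity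
T zero    a       = 1ℙ
T (suc b) zero    = 1ℙ
T (suc b) (suc a) = T b a ℙ.+ T b (suc a)

T-zero : ∀ b → T b 0 ≡ 1ℙ
T-zero zero    = refl
T-zero (suc b) = refl

-- Row b + 1 belongs to (1 + x)ᵇ, which has degree b.
T-vanish : ∀ {b a} → b < a → T (suc b) a ≡ 0ℙ
T-vanish {zero}  {suc a} _         = refl
T-vanish {suc b} {suc a} (s≤s b<a) = cong₂ ℙ._+_ (T-vanish b<a) (T-vanish (<-trans b<a (n<1+n a)))

-- Squaring: (1 + x)²ᵇ⁻¹ = (1 + x) (1 + x²)ᵇ⁻¹ and (1 + x)²ᵇ = (1 + x²)ᵇ.
T-even-even : ∀ b a → T (b * 2) (a * 2) ≡ T b a
T-even-odd  : ∀ b a → T (b * 2) (suc (a * 2)) ≡ T b a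
T-odd-even  : ∀ b a → T (suc (b * 2)) (a * 2) ≡ T (suc b) a
T-odd-odd   : ∀ b a → T (suc (b * 2)) (suc (a * 2)) ≡ 0ℙ

T-even-even zero    a       = refl
T-even-even (suc b) zero    = refl
T-even-even (suc b) (suc a) = cong₂ ℙ._+_ (T-odd-odd b a) (T-odd-even b (suc a))

T-even-odd zero    a = refl
T-even-odd (suc b) a = trans (cong₂ ℙ._+_ (T-odd-even b a) (T-odd-odd b a)) (ℙ.+-identityʳ _)

T-odd-even b zero    = refl
T-odd-even b (suc a) = cong₂ ℙ._+_ (T-even-odd b a) (T-even-even b (suc a))

T-odd-odd b a = trans (cong₂ ℙ._+_ (T-even-even b a) (T-even-odd b a)) (ℙ.p+p≡0ℙ (T b a))

rowSum : ℕ → ℕ → ℕ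
rowSum n b = Σ< n (λ a → value (T b a))

rowSum-even : ∀ n b → rowSum (n * 2) (b * 2) ≡ rowSum n b + rowSum n b
rowSum-even n b = begin
  rowSum (n * 2) (b * 2)
    ≡⟨ Σ<-double (λ a → value (T (b * 2) a)) n ⟩
  Σ< n (λ a → value (T (b * 2) (a * 2)) + value (T (b * 2) (suc (a * 2))))
    ≡⟨ Σ<-cong n (λ a _ → cong₂ (λ x y → value x + value y) (T-even-even b a) (T-even-odd b a)) ⟩
  Σ< n (λ a → value (T b a) + value (T b a))
    ≡⟨ Σ<-+ (value ∘ T b) (value ∘ T b) n ⟩
  rowSum n b + rowSum n b ∎
  where open ≡-Reasoning

rowSum-odd : ∀ n b → rowSum (n * 2) (suc (b * 2)) ≡ rowSum n (suc b)
rowSum-odd n b = begin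
  rowSum (n * 2) (suc (b * 2))
    ≡⟨ Σ<-double (λ a → value (T (suc (b * 2)) a)) n ⟩
  Σ< n (λ a → value (T (suc (b * 2)) (a * 2)) + value (T (suc (b * 2)) (suc (a * 2))))
    ≡⟨ Σ<-cong n (λ a _ → trans
         (cong₂ (λ x y → value x + value y) (T-odd-even b a) (T-odd-odd b a)) (+-identityʳ _)) ⟩
  rowSum n (suc b) ∎
  where open ≡-Reasoning

-- Row 2ʳ belongs to (1 + x) to the power 2ʳ - 1, whose 2ʳ coefficients are all 1, as in row 0. This
-- lets `squareSum` exchange one row for the other.
rowSum-last : ∀ r → rowSum (2 ^ r) (2 ^ r) ≡ rowSum (2 ^ r) 0
rowSum-last zero    = refl
rowSum-last (suc r) rewrite *-comm 2 (2 ^ r) = begin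
  rowSum (2 ^ r * 2) (2 ^ r * 2)                   ≡⟨ rowSum-even (2 ^ r) (2 ^ r) ⟩
  rowSum (2 ^ r) (2 ^ r) + rowSum (2 ^ r) (2 ^ r)  ≡⟨ cong (λ s → s + s) (rowSum-last r) ⟩
  rowSum (2 ^ r) 0 + rowSum (2 ^ r) 0              ≡⟨ rowSum-even (2 ^ r) 0 ⟨
  rowSum (2 ^ r * 2) 0                             ∎
  where open ≡-Reasoning

-- Doubling the size triples the sum: row 2b counts row b twice and row 2b + 1 counts row b + 1
-- once. The odd rows thus run over rows 1 to 2ʳ, and the last of these may be replaced by row 0.
squareSum : ∀ r → Σ< (2 ^ r) (rowSum (2 ^ r)) ≡ 3 ^ r
squareSum zero    = refl
squareSum (suc r) rewrite *-comm 2 (2 ^ r) = begin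
  Σ< (q * 2) (rowSum (q * 2))
    ≡⟨ Σ<-double (rowSum (q * 2)) q ⟩
  Σ< q (λ b → rowSum (q * 2) (b * 2) + rowSum (q * 2) (suc (b * 2)))
    ≡⟨ Σ<-cong q (λ b _ → cong₂ _+_ (rowSum-even q b) (rowSum-odd q b)) ⟩
  Σ< q (λ b → rowSum q b + rowSum q b + rowSum q (suc b))
    ≡⟨ Σ<-+ (λ b → rowSum q b + rowSum q b) (rowSum q ∘ suc) q ⟩
  Σ< q (λ b → rowSum q b + rowSum q b) + Σ< q (rowSum q ∘ suc)
    ≡⟨ cong₂ _+_ (Σ<-+ (rowSum q) (rowSum q) q) (Σ<-rotate (rowSum q) q (rowSum-last r)) ⟩
  S + S + S
    ≡⟨ triple S ⟩
  3 * S
    ≡⟨ cong (3 *_) (squareSum r) ⟩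
  3 ^ suc r ∎
  where
  open ≡-Reasoning
  q = 2 ^ r
  S = Σ< q (rowSum q)
  triple : ∀ s → s + s + s ≡ 3 * s
  triple = solve-∀

-- The sequence with C n = 1 for n < q and C (n + q) = C n + C (n + 1)

module Recurrence (C : ℕ → Parity) (p : ℕ) (C-init : ∀ {n} → n < 2+ p → C n ≡ 1ℙ)
                  (C-rec : ∀ n → C (n + 2+ p) ≡ C n ℙ.+ C (suc n)) where

  q : ℕ
  q = 2+ p

  -- In terms of the shift operator S this is (S^q)^(2^j) = (1 + S)^(2^j) = 1 + S^(2^j).
  C-frobenius : ∀ j n → C (n + 2 ^ j * q) ≡ C n ℙ.+ C (n + 2 ^ j)
  C-frobenius zero    n = begin
    C (n + (q + 0))      ≡⟨ cong (λ m → C (n + m)) (+-identityʳ q) ⟩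
    C (n + q)            ≡⟨ C-rec n ⟩
    C n ℙ.+ C (suc n)    ≡⟨ cong (λ m → C n ℙ.+ C m) (+-comm 1 n) ⟩
    C n ℙ.+ C (n + 1)    ∎
    where open ≡-Reasoning
  C-frobenius (suc j) n = begin
    C (n + 2 * 2 ^ j * q)
      ≡⟨ cong C (split n (2 ^ j) q) ⟩
    C (n + 2 ^ j * q + 2 ^ j * q)
      ≡⟨ C-frobenius j (n + 2 ^ j * q) ⟩
    C (n + 2 ^ j * q) ℙ.+ C (n + 2 ^ j * q + 2 ^ j)
      ≡⟨ cong (λ m → C (n + 2 ^ j * q) ℙ.+ C m) (swap n (2 ^ j * q) (2 ^ j)) ⟩
    C (n + 2 ^ j * q) ℙ.+ C (n + 2 ^ j + 2 ^ j * q)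
      ≡⟨ cong₂ ℙ._+_ (C-frobenius j n) (C-frobenius j (n + 2 ^ j)) ⟩
    C n ℙ.+ C (n + 2 ^ j) ℙ.+ (C (n + 2 ^ j) ℙ.+ C (n + 2 ^ j + 2 ^ j))
      ≡⟨ cancel (C n) (C (n + 2 ^ j)) _ ⟩
    C n ℙ.+ C (n + 2 ^ j + 2 ^ j)
      ≡⟨ cong (λ m → C n ℙ.+ C m) (double n (2 ^ j)) ⟩
    C n ℙ.+ C (n + 2 ^ suc j) ∎
    where
    open ≡-Reasoning
    split : ∀ n x q → n + 2 * x * q ≡ n + x * q + x * q
    split = solve-∀
    swap : ∀ n x y → n + x + y ≡ n + y + x
    swap = solve-∀
    double : ∀ n x → n + x + x ≡ n + 2 * x
    double = solve-∀
    cancel : ∀ a b c → a ℙ.+ b ℙ.+ (b ℙ.+ c) ≡ a ℙ.+ c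
    cancel a b c = begin
      a ℙ.+ b ℙ.+ (b ℙ.+ c)   ≡⟨ ℙ.+-assoc a b _ ⟩
      a ℙ.+ (b ℙ.+ (b ℙ.+ c)) ≡⟨ cong (a ℙ.+_) (ℙ.+-assoc b b c) ⟨
      a ℙ.+ (b ℙ.+ b ℙ.+ c)   ≡⟨ cong (λ x → a ℙ.+ (x ℙ.+ c)) (ℙ.p+p≡0ℙ b) ⟩
      a ℙ.+ c                 ∎

  -- Here α is the distance of column a from the right end of its row. `C-rec` adds an entry and its
  -- right neighbour, which in terms of α is Pascal's rule.
  C-table : ∀ b {α a} → b < q → α + a ≡ suc p → C (a + b * q) ≡ T b α
  C-table zero    {α} {a} _     α+a = C-init
    (subst (_< q) (sym (+-identityʳ a)) (s≤s (subst (a ≤_) α+a (m≤n+m a α))))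
  C-table (suc b) {α} {a} 1+b<q α+a = begin
    C (a + (q + b * q))                  ≡⟨ cong C (swap a q (b * q)) ⟩
    C (a + b * q + q)                    ≡⟨ C-rec (a + b * q) ⟩
    C (a + b * q) ℙ.+ C (suc a + b * q)  ≡⟨ next α a α+a ⟩
    T (suc b) α                          ∎
    where
    open ≡-Reasoning
    swap : ∀ a q x → a + (q + x) ≡ a + x + q
    swap = solve-∀
    b<q : b < q
    b<q = <-trans (n<1+n b) 1+b<q
    next-suc : ∀ α a → suc α + a ≡ suc p →
               C (a + b * q) ℙ.+ C (suc a + b * q) ≡ T (suc b) (suc α)
    next-suc α a α+a = begin
      C (a + b * q) ℙ.+ C (suc a + b * q)
        ≡⟨ ℙ.+-comm (C (a + b * q)) _ ⟩
      C (suc a + b * q) ℙ.+ C (a + b * q)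
        ≡⟨ cong₂ ℙ._+_ (C-table b b<q (trans (+-suc α a) α+a)) (C-table b b<q α+a) ⟩
      T b α ℙ.+ T b (suc α) ∎
    next : ∀ α a → α + a ≡ suc p → C (a + b * q) ℙ.+ C (suc a + b * q) ≡ T (suc b) α
    next (suc α) a  α+a  = next-suc α a α+a
    -- At the right end the neighbour is the first entry of row b + 1. It is again found from row b,
    -- as the coefficient of the power q - 1 of x in (1 + x)ᵇ, and vanishes because b < q - 1.
    next zero    .(suc p) refl = begin
      C (suc p + b * q) ℙ.+ C (q + b * q)
        ≡⟨ cong₂ ℙ._+_ (trans (C-table b {0} b<q refl) (T-zero b)) (begin
             C (q + b * q)                  ≡⟨ cong C (+-comm q (b * q)) ⟩
             C (b * q + q)                  ≡⟨ C-rec (b * q) ⟩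
             C (b * q) ℙ.+ C (suc (b * q))  ≡⟨ next-suc p 0 (+-identityʳ (suc p)) ⟩
             T (suc b) (suc p)              ≡⟨ T-vanish (≤-pred 1+b<q) ⟩
             0ℙ                             ∎) ⟩
      1ℙ ∎

  C-row : ∀ {b} → b < q → Σ< q (λ a → value (C (a + b * q))) ≡ rowSum q b
  C-row {b} b<q = begin
    Σ< q (λ a → value (C (a + b * q)))              ≡⟨ Σ<-reverse (λ a → value (C (a + b * q))) q ⟩
    Σ< q (λ α → value (C (q ∸ suc α + b * q)))      ≡⟨ Σ<-cong q (λ α α<q → cong value (C-table b {α} b<q (m+[n∸m]≡n (≤-pred α<q)))) ⟩
    rowSum q b                                      ∎
    where open ≡-Reasoning

  module _ (r N : ℕ) (q≡2^r : q ≡ 2 ^ r) (q*q≡1+N : q * q ≡ suc N) where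

    -- The Frobenius identity for j = r reads C(n + q²) = C(n) + C(n + q), and `C-rec` turns the
    -- right side into C(n + 1). The period q² - 1 is therefore obtained for arguments from 1 on.
    C-periodic : ∀ n → C (suc n + N) ≡ C (suc n)
    C-periodic n = begin
      C (suc n + N)                   ≡⟨ cong C (trans (sym (+-suc n N)) (cong (n +_) (sym q*q≡1+N))) ⟩
      C (n + q * q)                   ≡⟨ cong (λ x → C (n + x * q)) q≡2^r ⟩
      C (n + 2 ^ r * q)               ≡⟨ C-frobenius r n ⟩
      C n ℙ.+ C (n + 2 ^ r)           ≡⟨ cong (λ x → C n ℙ.+ C (n + x)) q≡2^r ⟨
      C n ℙ.+ C (n + q)               ≡⟨ cong (C n ℙ.+_) (C-rec n) ⟩
      C n ℙ.+ (C n ℙ.+ C (suc n))     ≡⟨ ℙ.+-assoc (C n) (C n) _ ⟨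
      C n ℙ.+ C n ℙ.+ C (suc n)       ≡⟨ cong (ℙ._+ C (suc n)) (ℙ.p+p≡0ℙ (C n)) ⟩
      C (suc n)                       ∎
      where open ≡-Reasoning

    C-total : Σ< (suc N) (value ∘ C) ≡ 3 ^ r
    C-total = begin
      Σ< (suc N) (value ∘ C)
        ≡⟨ cong (λ n → Σ< n (value ∘ C)) q*q≡1+N ⟨
      Σ< (q * q) (value ∘ C)
        ≡⟨ Σ<-* (value ∘ C) q q ⟩
      Σ< q (λ b → Σ< q (λ a → value (C (a + b * q))))
        ≡⟨ Σ<-cong q (λ b → C-row) ⟩
      Σ< q (rowSum q)
        ≡⟨ cong (λ n → Σ< n (rowSum n)) q≡2^r ⟩
      Σ< (2 ^ r) (rowSum (2 ^ r))
        ≡⟨ squareSum r ⟩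
      3 ^ r ∎
      where open ≡-Reasoning

    -- The first q² = N + 1 terms consist of C(0) = 1 and one full period starting at 1, whence the
    -- `∸ 1`.
    C-window : ∀ m → Σ< N (λ i → value (C (suc m + i))) ≡ 3 ^ r ∸ 1
    C-window m = trans (Σ<-period (value ∘ C ∘ suc) N (cong value ∘ C-periodic) m) (begin
      Σ< N (value ∘ C ∘ suc)                   ≡⟨⟩
      suc (Σ< N (value ∘ C ∘ suc)) ∸ 1         ≡⟨ cong (λ x → value x + Σ< N (value ∘ C ∘ suc) ∸ 1) (C-init {0} z<s) ⟨
      Σ< (suc N) (value ∘ C) ∸ 1               ≡⟨ cong (_∸ 1) C-total ⟩
      3 ^ r ∸ 1                                ∎)
      where open ≡-Reasoning

-- Periods

module _ {s : ℕ → ℕ} where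

  period-* : ∀ {p} → IsPeriod s p → ∀ k n → s (n + k * p) ≡ s n
  period-* {p} per zero    n = cong s (+-identityʳ n)
  period-* {p} per (suc k) n = begin
    s (n + (p + k * p))  ≡⟨ cong s (swap n p (k * p)) ⟩
    s (n + k * p + p)    ≡⟨ proj₂ per (n + k * p) ⟩
    s (n + k * p)        ≡⟨ period-* per k n ⟩
    s n                  ∎
    where
    open ≡-Reasoning
    swap : ∀ a q x → a + (q + x) ≡ a + x + q
    swap = solve-∀

  -- A known period N reduces the test to the finitely many n < N; this decidability makes the
  -- search for a least period constructive.
  period? : ∀ {N} → IsPeriod s N → ∀ p → Dec (IsPeriod s p)
  period? {N} per p = (0 <? p) ×-dec map′ extend (λ e {n} _ → e n)
                        (allUpTo? (λ n → s (n + p) ≟ s n) N)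
    where
    instance _ = >-nonZero (proj₁ per)
    extend : (∀ {n} → n < N → s (n + p) ≡ s n) → ∀ n → s (n + p) ≡ s n
    extend e n = begin
      s (n + p)                        ≡⟨ cong (λ m → s (m + p)) (m≡m%n+[m/n]*n n N) ⟩
      s (n % N + n / N * N + p)        ≡⟨ cong s (swap (n % N) (n / N * N) p) ⟩
      s (n % N + p + n / N * N)        ≡⟨ period-* per (n / N) (n % N + p) ⟩
      s (n % N + p)                    ≡⟨ e (m%n<n n N) ⟩
      s (n % N)                        ≡⟨ period-* per (n / N) (n % N) ⟨
      s (n % N + n / N * N)            ≡⟨ cong s (m≡m%n+[m/n]*n n N) ⟨
      s n                              ∎
      where
      open ≡-Reasoning
      swap : ∀ a b c → a + b + c ≡ a + c + b
      swap = solve-∀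

  leastPeriod : ∀ N → IsPeriod s N → ∃[ p ] IsLeastPeriod s p
  leastPeriod = <-rec _ step
    where
    step : ∀ N → (∀ {m} → m < N → IsPeriod s m → ∃[ p ] IsLeastPeriod s p) →
           IsPeriod s N → ∃[ p ] IsLeastPeriod s p
    step N rec per with anyUpTo? (period? per) N
    ... | yes (m , m<N , per-m) = rec m<N per-m
    ... | no  none              = N , per , λ m per-m → ≮⇒≥ (λ m<N → none (m , m<N , per-m))

  -- A nonzero remainder N % p would be a period smaller than p.
  leastPeriod-∣ : ∀ {p N} → IsLeastPeriod s p → IsPeriod s N → p ∣ N
  leastPeriod-∣ {p} {N} (per , least) per-N =
    m%n≡0⇒n∣m N p (n≤0⇒n≡0 (≮⇒≥ λ 0<N%p → <⇒≱ (m%n<n N p) (least (N % p) (0<N%p , residue))))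
    where
    instance _ = >-nonZero (proj₁ per)
    residue : ∀ n → s (n + N % p) ≡ s n
    residue n = begin
      s (n + N % p)                  ≡⟨ period-* per (N / p) (n + N % p) ⟨
      s (n + N % p + N / p * p)      ≡⟨ cong s (+-assoc n (N % p) _) ⟩
      s (n + (N % p + N / p * p))    ≡⟨ cong (λ m → s (n + m)) (m≡m%n+[m/n]*n N p) ⟨
      s (n + N)                      ≡⟨ proj₂ per-N n ⟩
      s n                            ∎
      where open ≡-Reasoning

-- Occurrences

n%2≡value[parity] : ∀ n → n % 2 ≡ value (parity n)
n%2≡value[parity] 0        = refl
n%2≡value[parity] 1        = refl
n%2≡value[parity] (2+ n) = trans
  (trans (cong (_% 2) (+-comm 2 n)) ([m+n]%n≡m%n n 2)) (n%2≡value[parity] n)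

module _ {A : Set} {P : Pred A 0ℓ} (P? : Decidable P) where

  length-filter-applyUpTo : ∀ (g : ℕ → A) (h : ℕ → ℕ) n →
    (∀ i → length (filter P? (g i ∷ [])) ≡ h i) → length (filter P? (applyUpTo g n)) ≡ Σ< n h
  length-filter-applyUpTo g h zero    eq = refl
  length-filter-applyUpTo g h (suc n) eq = begin
    length (filter P? (g 0 ∷ applyUpTo (g ∘ suc) n))
      ≡⟨ cong length (filter-++ P? (g 0 ∷ []) _) ⟩
    length (filter P? (g 0 ∷ []) ++ filter P? (applyUpTo (g ∘ suc) n))
      ≡⟨ length-++ (filter P? (g 0 ∷ [])) ⟩
    length (filter P? (g 0 ∷ [])) + length (filter P? (applyUpTo (g ∘ suc) n))
      ≡⟨ cong₂ _+_ (eq 0) (length-filter-applyUpTo (g ∘ suc) (h ∘ suc) n (eq ∘ suc)) ⟩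
    Σ< (suc n) h ∎
    where open ≡-Reasoning

module _ (s : ℕ → ℕ) (p : ℕ → Parity) (s≡p : ∀ n → s n ≡ value (p n)) (m N : ℕ) where

  occurrences-1 : occurrences s 1 m N ≡ Σ< N (λ i → value (p (m + i)))
  occurrences-1 = length-filter-applyUpTo _ _ _ N one
    where
    one : ∀ i → length (filter (λ i → s (m + i) ≟ 1) (i ∷ [])) ≡ value (p (m + i))
    one i rewrite s≡p (m + i) with p (m + i)
    ... | 0ℙ = refl
    ... | 1ℙ = refl

  occurrences-0 : occurrences s 0 m N ≡ Σ< N (λ i → value (p (m + i) ⁻¹))
  occurrences-0 = length-filter-applyUpTo _ _ _ N one
    where
    one : ∀ i → length (filter (λ i → s (m + i) ≟ 0) (i ∷ [])) ≡ value (p (m + i) ⁻¹)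
    one i rewrite s≡p (m + i) with p (m + i)
    ... | 0ℙ = refl
    ... | 1ℙ = refl

  occurrences-1+0 : occurrences s 1 m N + occurrences s 0 m N ≡ N
  occurrences-1+0 = begin
    occurrences s 1 m N + occurrences s 0 m N
      ≡⟨ cong₂ _+_ occurrences-1 occurrences-0 ⟩
    Σ< N (λ i → value (p (m + i))) + Σ< N (λ i → value (p (m + i) ⁻¹))
      ≡⟨ Σ<-+ (λ i → value (p (m + i))) _ N ⟨
    Σ< N (λ i → value (p (m + i)) + value (p (m + i) ⁻¹))
      ≡⟨ Σ<-cong N (λ i _ → complement (p (m + i))) ⟩
    Σ< N (λ _ → 1)
      ≡⟨ Σ<-1 N ⟩
    N ∎
    where
    open ≡-Reasoning
    complement : ∀ x → value x + value (x ⁻¹) ≡ 1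
    complement 0ℙ = refl
    complement 1ℙ = refl

-- The digit set and its polynomial

deduplicate-unique : ∀ {xs} → Unique xs → deduplicate _≟_ xs ≡ xs
deduplicate-unique []                 = refl
deduplicate-unique {x ∷ xs} (x∉ ∷ xs!) = cong (x ∷_)
  (trans (cong (filter (¬? ∘ (x ≟_))) (deduplicate-unique xs!)) (filter-all (¬? ∘ (x ≟_)) x∉))

-- The list is strictly increasing because 2ʳ ≥ 8.
𝒜-unique : ∀ {r} → 3 ≤ r → Unique (𝒜 r)
𝒜-unique {r} 3≤r =
  ((λ ()) All.∷ <⇒≢ (<-trans z<s 1<2^r-1) All.∷ <⇒≢ (<-trans z<s 1<2^r+1) All.∷ All.[])
  ∷ (<⇒≢ 1<2^r-1 All.∷ <⇒≢ 1<2^r+1 All.∷ All.[])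
  ∷ (<⇒≢ 2^r-1<2^r+1 All.∷ All.[])
  ∷ All.[] ∷ []
  where
  8≤2^r : 8 ≤ 2 ^ r
  8≤2^r = ^-monoʳ-≤ 2 3≤r
  2^r-1<2^r+1 : 2 ^ r ∸ 1 < 2 ^ r + 1
  2^r-1<2^r+1 = ≤-<-trans (m∸n≤m (2 ^ r) 1) (m<m+n (2 ^ r) z<s)
  1<2^r-1 : 1 < 2 ^ r ∸ 1
  1<2^r-1 = ≤-trans (s≤s (s≤s z≤n)) (∸-monoˡ-≤ 1 8≤2^r)
  1<2^r+1 : 1 < 2 ^ r + 1
  1<2^r+1 = <-trans 1<2^r-1 2^r-1<2^r+1

elements-𝒜 : ∀ {r} → 3 ≤ r → elements (𝒜 r) ≡ 𝒜 r
elements-𝒜 = deduplicate-unique ∘ 𝒜-unique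

coeff-⊕ : ∀ p p′ i → coeff (p ⊕ p′) i ≡ coeff p i ℙ.+ coeff p′ i
coeff-⊕ []      p′       i       = refl
coeff-⊕ (c ∷ p) []       i       = sym (ℙ.+-identityʳ _)
coeff-⊕ (c ∷ p) (d ∷ p′) zero    = refl
coeff-⊕ (c ∷ p) (d ∷ p′) (suc i) = coeff-⊕ p p′ i

X^1≈X : X ^ₚ 1 ≈ₚ X
X^1≈X 0      = refl
X^1≈X 1      = refl
X^1≈X (2+ _) = refl

-- The fold in `φ` nests to the right and ends in `0ₚ`; the rebracketing is done in each
-- coefficient, with associativity in `Parity`.
φ-𝒜 : ∀ {r} → 3 ≤ r → φ (𝒜 r) ≈ₚ 1ₚ ⊕ X ⊕ X ^ₚ (2 ^ r ∸ 1) ⊕ X ^ₚ (2 ^ r + 1)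
φ-𝒜 {r} 3≤r i = begin
  coeff (φ (𝒜 r)) i
    ≡⟨ cong (λ as → coeff (foldr (λ a p → X ^ₚ a ⊕ p) 0ₚ as) i) (elements-𝒜 3≤r) ⟩
  coeff (1ₚ ⊕ (X ^ₚ 1 ⊕ (Y ⊕ (Z ⊕ 0ₚ)))) i
    ≡⟨ trans (coeff-⊕ 1ₚ (X ^ₚ 1 ⊕ (Y ⊕ (Z ⊕ 0ₚ))) i) (cong (coeff 1ₚ i ℙ.+_)
         (trans (coeff-⊕ (X ^ₚ 1) (Y ⊕ (Z ⊕ 0ₚ)) i) (cong₂ ℙ._+_ (X^1≈X i)
           (trans (coeff-⊕ Y (Z ⊕ 0ₚ) i) (cong (coeff Y i ℙ.+_)
             (trans (coeff-⊕ Z 0ₚ i) (ℙ.+-identityʳ _))))))) ⟩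
  coeff 1ₚ i ℙ.+ (coeff X i ℙ.+ (coeff Y i ℙ.+ coeff Z i))
    ≡⟨ ℙ.+-assoc (coeff 1ₚ i) (coeff X i) _ ⟨
  coeff 1ₚ i ℙ.+ coeff X i ℙ.+ (coeff Y i ℙ.+ coeff Z i)
    ≡⟨ ℙ.+-assoc (coeff 1ₚ i ℙ.+ coeff X i) (coeff Y i) (coeff Z i) ⟨
  coeff 1ₚ i ℙ.+ coeff X i ℙ.+ coeff Y i ℙ.+ coeff Z i
    ≡⟨ trans (coeff-⊕ (1ₚ ⊕ X ⊕ Y) Z i) (cong (ℙ._+ coeff Z i)
         (trans (coeff-⊕ (1ₚ ⊕ X) Y i) (cong (ℙ._+ coeff Y i) (coeff-⊕ 1ₚ X i)))) ⟨
  coeff (1ₚ ⊕ X ⊕ Y ⊕ Z) i ∎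
  where
  open ≡-Reasoning
  Y = X ^ₚ (2 ^ r ∸ 1)
  Z = X ^ₚ (2 ^ r + 1)

-- The sequence f (𝒜 r) modulo 2

2^[1+r]≡q : ∀ r → 2 ^ suc r ≡ Digits.q (pred (2 ^ r))
2^[1+r]≡q r = trans (*-comm 2 (2 ^ r)) (cong (_* 2) (sym (suc-pred (2 ^ r) {{m^n≢0 2 r}})))

module Modulo2 (r : ℕ) (3≤1+r : 3 ≤ suc r) where

  open Digits (pred (2 ^ r)) using (q; C; C-init; C-rec; hits; hits≡C)

  N : ℕ
  N = 4 ^ suc r ∸ 1

  -- This is q - 2, written so that `2+ p` computes to `q`, as `Recurrence` expects.
  p : ℕ
  p = pred (2 ^ r) * 2

  s : ℕ → ℕ
  s n = f (𝒜 (suc r)) n % 2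

  1+N≡4^[1+r] : suc N ≡ 4 ^ suc r
  1+N≡4^[1+r] = m+[n∸m]≡n (m^n>0 4 (suc r))

  q*q≡1+N : q * q ≡ suc N
  q*q≡1+N = begin
    q * q                    ≡⟨ cong (λ x → x * x) (2^[1+r]≡q r) ⟨
    2 ^ suc r * 2 ^ suc r    ≡⟨ ^-distribˡ-+-* 2 (suc r) (suc r) ⟨
    2 ^ (suc r + suc r)      ≡⟨ cong (λ x → 2 ^ (suc r + x)) (+-identityʳ (suc r)) ⟨
    2 ^ (2 * suc r)          ≡⟨ ^-*-assoc 2 2 (suc r) ⟨
    4 ^ suc r                ≡⟨ 1+N≡4^[1+r] ⟨
    suc N                    ∎
    where open ≡-Reasoning

  0<N : 0 < N
  0<N = ∸-monoˡ-≤ 1 (≤-trans (s≤s (s≤s z≤n)) (^-monoʳ-≤ 4 {1} {suc r} (s≤s z≤n)))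

  open Recurrence C p C-init C-rec using (C-periodic; C-window)

  digit-set : elements (𝒜 (suc r)) ≡ Digits.E (pred (2 ^ r))
  digit-set = trans (elements-𝒜 3≤1+r) (cong₂ (λ a b → 0 ∷ 1 ∷ a ∷ b ∷ [])
    (cong (_∸ 1) (2^[1+r]≡q r)) (trans (+-comm (2 ^ suc r) 1) (cong suc (2^[1+r]≡q r))))

  s≡C : ∀ n → s n ≡ value (C (n + q) ⁻¹)
  s≡C n = begin
    f (𝒜 (suc r)) n % 2               ≡⟨ n%2≡value[parity] (f (𝒜 (suc r)) n) ⟩
    -- `f` runs over words of length n, so with the digit set replaced by `E` its parity is
    -- `hits n 0 n` by computation.
    value (parity (f (𝒜 (suc r)) n))  ≡⟨ cong (λ E → value (count (λ w → weight n (digits w) ≟ n) (words E n))) digit-set ⟩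
    value (hits n 0 n)                ≡⟨ cong value (hits≡C n) ⟩
    value (C (n + q) ⁻¹)              ∎
    where open ≡-Reasoning

  -- C-periodic and C-window need an argument of C that is visibly positive.
  shift : ∀ m i → m + i + q ≡ suc (m + suc p) + i
  shift m i = rearrange m i p
    where
    rearrange : ∀ m i p → m + i + (2 + p) ≡ suc (m + suc p) + i
    rearrange = solve-∀

  s-period : IsPeriod s N
  s-period = 0<N , λ n → begin
    s (n + N)                          ≡⟨ s≡C (n + N) ⟩
    value (C (n + N + q) ⁻¹)           ≡⟨ cong (λ k → value (C k ⁻¹)) (shift n N) ⟩
    value (C (suc (n + suc p) + N) ⁻¹) ≡⟨ cong (λ x → value (x ⁻¹)) (C-periodic (suc r) N (sym (2^[1+r]≡q r)) q*q≡1+N (n + suc p)) ⟩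
    value (C (suc (n + suc p)) ⁻¹)     ≡⟨ cong (λ k → value (C k ⁻¹)) (+-suc n (suc p)) ⟨
    value (C (n + q) ⁻¹)               ≡⟨ s≡C n ⟨
    s n                                ∎
    where open ≡-Reasoning

  -- A term f(n) is even exactly when C(n + q) = 1, so these are the ones of `C` in a window of
  -- length N.
  even-terms : ∀ m → occurrences s 0 m N ≡ 3 ^ suc r ∸ 1
  even-terms m = begin
    occurrences s 0 m N
      ≡⟨ occurrences-0 s (λ n → C (n + q) ⁻¹) s≡C m N ⟩
    Σ< N (λ i → value (C (m + i + q) ⁻¹ ⁻¹))
      ≡⟨ Σ<-cong N (λ i _ → cong value (trans (ℙ.⁻¹-involutive _) (cong C (shift m i)))) ⟩
    Σ< N (λ i → value (C (suc (m + suc p) + i)))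
      ≡⟨ C-window (suc r) N (sym (2^[1+r]≡q r)) q*q≡1+N (m + suc p) ⟩
    3 ^ suc r ∸ 1 ∎
    where open ≡-Reasoning

  -- The rest of the window is odd: (4ʳ - 1) - (3ʳ - 1), with `suc r` in the role of r.
  odd-terms : ∀ m → occurrences s 1 m N ≡ 4 ^ suc r ∸ 3 ^ suc r
  odd-terms m = begin
    occurrences s 1 m N
      ≡⟨ m+n∸n≡m (occurrences s 1 m N) (occurrences s 0 m N) ⟨
    occurrences s 1 m N + occurrences s 0 m N ∸ occurrences s 0 m N
      ≡⟨ cong₂ _∸_ (occurrences-1+0 s (λ n → C (n + q) ⁻¹) s≡C m N) (even-terms m) ⟩
    4 ^ suc r ∸ 1 ∸ (3 ^ suc r ∸ 1)
      ≡⟨ ∸-+-assoc (4 ^ suc r) 1 (3 ^ suc r ∸ 1) ⟩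
    4 ^ suc r ∸ (1 + (3 ^ suc r ∸ 1))
      ≡⟨ cong (4 ^ suc r ∸_) (m+[n∸m]≡n (m^n>0 3 (suc r))) ⟩
    4 ^ suc r ∸ 3 ^ suc r ∎
    where open ≡-Reasoning

mainTheorem7 : ∀ (r : ℕ) → 3 ≤ r →
    (φ (𝒜 r) ≈ₚ 1ₚ ⊕ X ⊕ X ^ₚ (2 ^ r ∸ 1) ⊕ X ^ₚ (2 ^ r + 1))
    × (∃[ p ] (IsLeastPeriod (λ n → f (𝒜 r) n % 2) p × p ∣ 4 ^ r ∸ 1))
    × (∀ (m : ℕ) →
    occurrences (λ n → f (𝒜 r) n % 2) 1 m (4 ^ r ∸ 1) ≡ 4 ^ r ∸ 3 ^ r
    × occurrences (λ n → f (𝒜 r) n % 2) 0 m (4 ^ r ∸ 1) ≡ 3 ^ r ∸ 1)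
mainTheorem7 (suc r) 3≤1+r =
  φ-𝒜 3≤1+r ,
  (proj₁ least , proj₂ least , leastPeriod-∣ (proj₂ least) s-period) ,
  λ m → odd-terms m , even-terms m
  where
  open Modulo2 r 3≤1+r
  least : ∃[ p ] IsLeastPeriod s p
  least = leastPeriod N s-period
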